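{- There are (up to isomorphism) $2^{n-1}$ linearly ordered preorder forest $P$-frames with $n$ elements ($n\ge 1$). In the algebraic setting, for $n>1$, there are (up to isomorphism) $2^{n-2}$ unary-determined commutative doubly idempotent linear semirings with $n$ elements, and $n-1$ of them have an identity element.
   Context: A $P$-frame is a structure $(W,\le,P)$ where $(W,\le)$ is a poset and $P\subseteq W^2$ satisfies: $u\le x$, $xPy$, $y\le v$ imply $uPv$. A preorder forest $P$-frame is a $P$-frame in which $P$ is reflexive and transitive and which satisfies, for all $x,y,z$: $xPy$ and $xPz$ imply ($x\le y$ or $x\le z$ or $yPz$ or $zPy$). It is linearly ordered if $(W,\le)$ is a chain. A semiring here has two binary operations $\vee,\cdot$, where $\vee$ is associative and commutative, $\cdot$ is associative, and $\cdot$ distributes over $\vee$ from the left and right. It is doubly idempotent if $x\vee x=x$ and $x\cdot x=x$ for all $x$, and commutative if $x\cdot y=y\cdot x$ for all $x,y$. It is linear if the order given by $x\le y\iff x\vee y=y$ is a chain; in that case $\wedge$ denotes the meet (minimum) of this chain, and in the finite case $\top$ denotes its greatest element. It is unary-determined if $x\cdot y=((x\cdot\top)\wedge y)\vee(x\wedge(\top\cdot y))$ for all $x,y$. An identity element is an element $1$ with $1\cdot x=x=x\cdot 1$ for all $x$.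
   Formalization: The semirings are also required to have a least element that annihilates under ·; without this the counts fail (for n=2, both · = min and · = max on a two-element chain qualify). The relation P is assumed decidable, which is automatic classically for finite frames. -}

module Defs where

open import Algebra.Core using (Op₂)
open import Algebra.Definitions using
  (Idempotent; Commutative; Identity; Zero; _DistributesOver_)
open import Algebra.Morphism.Definitions using (Homomorphic₂)
open import Algebra.Structures using (IsSemigroup; IsCommutativeSemigroup)
open import Algebra.Construct.NaturalChoice.Min using (_⊓_)
open import Data.Fin.Base using (Fin)
open import Data.Nat.Base using (ℕ)
open import Data.Product.Base using (∃; _×_; proj₁)
open import Data.Sum.Base using (_⊎_)
open import Function.Base using (_∘_)
open import Function.Bundles using (_↔_; _⇔_; mk⇔; module Inverse; module Equivalence; Bijection)
open import Function.Construct.Composition using (_↔-∘_; _⇔-∘_)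
open import Function.Construct.Identity using (↔-id; ⇔-id)
open import Function.Construct.Symmetry using (↔-sym; ⇔-sym)
open import Level using (Level; 0ℓ)
open import Relation.Binary.Bundles using (Setoid; TotalOrder)
open import Relation.Binary.Core using (Rel)
open import Relation.Binary.Definitions using
  (Reflexive; Transitive; Total; Decidable; Maximum; Minimum)
open import Relation.Binary.Structures using (IsPartialOrder; IsTotalOrder)
open import Relation.Binary.PropositionalEquality
  using (_≡_; refl; sym; trans; cong; cong₂; subst₂; setoid; module ≡-Reasoning)
import Relation.Binary.Construct.On as On

-- The setoids below have isomorphism as their equality, so a bijection from
-- Fin N is a list of N structures, pairwise non-isomorphic and containing an
-- isomorphic copy of every structure of the class.
HasCardinality : ∀ {a ℓ} → Setoid a ℓ → ℕ → Set _
HasCardinality S N = Bijection (setoid (Fin N)) S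

------------------------------------------------------------------------
-- P-frames

record PFrame : Set₁ where
  infix 4 _≤_ _P_
  field
    Carrier        : Set
    _≤_            : Rel Carrier 0ℓ
    _P_            : Rel Carrier 0ℓ
    isPartialOrder : IsPartialOrder _≡_ _≤_
    P-closed       : ∀ {u x y v} → u ≤ x → x P y → y ≤ v → u P v

record IsPreorderForest (F : PFrame) : Set where
  open PFrame F
  field
    P-refl  : Reflexive _P_
    P-trans : Transitive _P_
    forest  : ∀ {x y z} → x P y → x P z → x ≤ y ⊎ x ≤ z ⊎ y P z ⊎ z P y

LinearlyOrdered : PFrame → Set
LinearlyOrdered F = Total (PFrame._≤_ F)

record _≅ᶠ_ (F G : PFrame) : Set where
  private
    module F = PFrame F
    module G = PFrame G
  field
    iso   : F.Carrier ↔ G.Carrier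
  open Inverse iso public using (to)
  field
    ≤-iso : ∀ x y → (x F.≤ y) ⇔ (to x G.≤ to y)
    P-iso : ∀ x y → (x F.P y) ⇔ (to x G.P to y)

private
  inverse⇔ : ∀ {A B : Set} {R : Rel A 0ℓ} {S : Rel B 0ℓ} (i : A ↔ B) →
             (∀ x y → R x y ⇔ S (Inverse.to i x) (Inverse.to i y)) →
             ∀ x y → S x y ⇔ R (Inverse.from i x) (Inverse.from i y)
  inverse⇔ {S = S} i h x y = mk⇔
    (Equivalence.from e ∘ subst₂ S (sym (Inverse.strictlyInverseˡ i x))
                                   (sym (Inverse.strictlyInverseˡ i y)))
    (subst₂ S (Inverse.strictlyInverseˡ i x) (Inverse.strictlyInverseˡ i y)
      ∘ Equivalence.to e)
    where e = h (Inverse.from i x) (Inverse.from i y)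

≅ᶠ-refl : ∀ {F} → F ≅ᶠ F
≅ᶠ-refl = record
  { iso   = ↔-id _
  ; ≤-iso = λ _ _ → ⇔-id _
  ; P-iso = λ _ _ → ⇔-id _
  }

≅ᶠ-sym : ∀ {F G} → F ≅ᶠ G → G ≅ᶠ F
≅ᶠ-sym f = record
  { iso   = ↔-sym iso
  ; ≤-iso = inverse⇔ iso ≤-iso
  ; P-iso = inverse⇔ iso P-iso
  }
  where open _≅ᶠ_ f

≅ᶠ-trans : ∀ {F G H} → F ≅ᶠ G → G ≅ᶠ H → F ≅ᶠ H
≅ᶠ-trans f g = record
  { iso   = g.iso ↔-∘ f.iso
  ; ≤-iso = λ x y → g.≤-iso (f.to x) (f.to y) ⇔-∘ f.≤-iso x y
  ; P-iso = λ x y → g.P-iso (f.to x) (f.to y) ⇔-∘ f.P-iso x y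
  }
  where
  module f = _≅ᶠ_ f
  module g = _≅ᶠ_ g

PFrame-setoid : Setoid _ _
PFrame-setoid = record
  { Carrier       = PFrame
  ; _≈_           = _≅ᶠ_
  ; isEquivalence = record { refl = ≅ᶠ-refl ; sym = ≅ᶠ-sym ; trans = ≅ᶠ-trans }
  }

-- On a finite carrier every relation is classically decidable; constructively
-- a finite frame has to come with a decision procedure for P (for ≤ it follows
-- from linearity and the enumeration of the carrier).
record IsLinearForest (n : ℕ) (F : PFrame) : Set where
  open PFrame F
  field
    size             : Fin n ↔ Carrier
    P?               : Decidable _P_
    isPreorderForest : IsPreorderForest F
    linearlyOrdered  : LinearlyOrdered F

LinearForests : ℕ → Setoid _ _
LinearForests n = On.setoid PFrame-setoid (proj₁ {B = IsLinearForest n})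

------------------------------------------------------------------------
-- Semirings

-- Unlike Algebra.Bundles.Semiring, there are no constants in the signature.
record Semiring : Set₁ where
  infixl 7 _·_
  infixl 6 _∨_
  field
    Carrier                  : Set
    _∨_ _·_                  : Op₂ Carrier
    ∨-isCommutativeSemigroup : IsCommutativeSemigroup _≡_ _∨_
    ·-isSemigroup            : IsSemigroup _≡_ _·_
    distrib                  : _DistributesOver_ _≡_ _·_ _∨_

  infix 4 _≤_
  _≤_ : Rel Carrier 0ℓ
  x ≤ y = x ∨ y ≡ y

DoublyIdempotent : Semiring → Set
DoublyIdempotent S = Idempotent _≡_ _∨_ × Idempotent _≡_ _·_
  where open Semiring S

Linear : Semiring → Set
Linear S = IsTotalOrder _≡_ (Semiring._≤_ S)

UnaryDetermined : (S : Semiring) → Linear S → Set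
UnaryDetermined S linear =
  ∃ λ ⊤ → Maximum _≤_ ⊤ × (∀ x y → x · y ≡ ((x · ⊤) ∧ y) ∨ (x ∧ (⊤ · y)))
  where
  open Semiring S
  _∧_ : Op₂ Carrier
  _∧_ = _⊓_ (record { isTotalOrder = linear })

-- Preservation of the empty join by · in each argument: the finitary
-- distributive laws of Semiring only cover non-empty joins.
HasZero : Semiring → Set
HasZero S = ∃ λ ⊥ → Minimum _≤_ ⊥ × Zero _≡_ ⊥ _·_
  where open Semiring S

HasIdentity : Semiring → Set
HasIdentity S = ∃ λ e → Identity _≡_ e (Semiring._·_ S)

record _≅ˢ_ (S T : Semiring) : Set where
  private
    module S = Semiring S
    module T = Semiring T
  field
    iso    : S.Carrier ↔ T.Carrier
  open Inverse iso public using (to)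
  field
    ∨-homo : Homomorphic₂ S.Carrier T.Carrier _≡_ to S._∨_ T._∨_
    ·-homo : Homomorphic₂ S.Carrier T.Carrier _≡_ to S._·_ T._·_

private
  inverse-homo : ∀ {A B : Set} {_∙_ : Op₂ A} {_∘_ : Op₂ B} (i : A ↔ B) →
                 Homomorphic₂ A B _≡_ (Inverse.to i) _∙_ _∘_ →
                 Homomorphic₂ B A _≡_ (Inverse.from i) _∘_ _∙_
  inverse-homo {_∙_ = _∙_} {_∘_ = _∘_} i homo x y = begin
    from (x ∘ y)                     ≡⟨ cong from (cong₂ _∘_ (strictlyInverseˡ x) (strictlyInverseˡ y)) ⟨
    from (to (from x) ∘ to (from y)) ≡⟨ cong from (homo (from x) (from y)) ⟨
    from (to (from x ∙ from y))      ≡⟨ strictlyInverseʳ (from x ∙ from y) ⟩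
    from x ∙ from y                  ∎
    where
    open Inverse i
    open ≡-Reasoning

≅ˢ-refl : ∀ {S} → S ≅ˢ S
≅ˢ-refl = record
  { iso    = ↔-id _
  ; ∨-homo = λ _ _ → refl
  ; ·-homo = λ _ _ → refl
  }

≅ˢ-sym : ∀ {S T} → S ≅ˢ T → T ≅ˢ S
≅ˢ-sym f = record
  { iso    = ↔-sym iso
  ; ∨-homo = inverse-homo iso ∨-homo
  ; ·-homo = inverse-homo iso ·-homo
  }
  where open _≅ˢ_ f

≅ˢ-trans : ∀ {S T U} → S ≅ˢ T → T ≅ˢ U → S ≅ˢ U
≅ˢ-trans f g = record
  { iso    = g.iso ↔-∘ f.iso
  ; ∨-homo = λ x y → trans (cong g.to (f.∨-homo x y)) (g.∨-homo (f.to x) (f.to y))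
  ; ·-homo = λ x y → trans (cong g.to (f.·-homo x y)) (g.·-homo (f.to x) (f.to y))
  }
  where
  module f = _≅ˢ_ f
  module g = _≅ˢ_ g

Semiring-setoid : Setoid _ _
Semiring-setoid = record
  { Carrier       = Semiring
  ; _≈_           = _≅ˢ_
  ; isEquivalence = record { refl = ≅ˢ-refl ; sym = ≅ˢ-sym ; trans = ≅ˢ-trans }
  }

-- Without hasZero the counts would be 2 ^ (n ∸ 1), of which n with an
-- identity: on the chain ⊥ < ⊤, both · = ∧ and · = ∨ satisfy all the other
-- fields.
record IsUnaryDeterminedChain (n : ℕ) (S : Semiring) : Set where
  open Semiring S
  field
    size             : Fin n ↔ Carrier
    hasZero          : HasZero S
    commutative      : Commutative _≡_ _·_
    doublyIdempotent : DoublyIdempotent S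
    linear           : Linear S
    unaryDetermined  : UnaryDetermined S linear

UnaryDeterminedChains : ℕ → Setoid _ _
UnaryDeterminedChains n =
  On.setoid Semiring-setoid (proj₁ {B = IsUnaryDeterminedChain n})

UnaryDeterminedChainsWithIdentity : ℕ → Setoid _ _
UnaryDeterminedChainsWithIdentity n =
  On.setoid Semiring-setoid
    (proj₁ {B = λ S → IsUnaryDeterminedChain n S × HasIdentity S})

{-# OPTIONS --safe #-}
-- Since P is reflexive and ≤-closed, it contains ≤; on a chain the forest axiom
-- then holds automatically, and P is a total preorder extending the order. It is
-- determined by the set of k for which k and its successor are equivalent, so
-- there are n - 1 free bits.
--
-- A unary-determined chain is determined by f x = x · ⊤, which is a closure
-- operator fixing ⊥, and every such f arises, through
-- x · y = (f x ∧ y) ∨ (x ∧ f y). On the n - 1 elements other than ⊥ the relation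
-- x ≤ f y is again a total preorder extending the order, which leaves n - 2 bits.
-- An element e is an identity exactly when f fixes everything below e and sends
-- everything from e upwards to ⊤, so f is determined by e, and e may be any
-- element other than ⊥.
module Submission where

open import Defs
open import Algebra.Consequences.Propositional using (comm∧distrˡ⇒distrʳ)
open import Algebra.Construct.NaturalChoice.Base using (MinOperator; MaxOperator)
import Algebra.Construct.NaturalChoice.Max as NaturalMax
import Algebra.Construct.NaturalChoice.Min as NaturalMin
import Algebra.Construct.NaturalChoice.MinMaxOp as MinMaxOp
open import Algebra.Core using (Op₂)
open import Algebra.Definitions
  using (Associative; Commutative; Idempotent; Identity; _DistributesOverˡ_)
open import Algebra.Structures using (IsSemigroup; IsCommutativeSemigroup)
open import Data.Fin.Base
  using (Fin; zero; suc; toℕ; inject₁; fromℕ; fromℕ<; punchOut; combine; finToFun; funToFin;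
         _≤_; _<_)
open import Data.Fin.Induction using (<-weakInduction)
open import Data.Fin.Patterns using (0F; 1F)
import Data.Fin.Properties as Fin
open import Data.Fin.Subset using (Subset; _∈_; ∣_∣)
open import Data.Fin.Subset.Properties using (∈⊤; ∣⊤∣≡n; p⊆q⇒∣p∣≤∣q∣; p⊂q⇒∣p∣<∣q∣)
open import Data.Nat.Base using (ℕ; zero; suc; z≤n; s≤s; _^_; _∸_; _≥_; _>_)
import Data.Nat.Base as ℕ
import Data.Nat.Properties as ℕ
open import Data.Product.Base using (∃; _×_; _,_; proj₁; proj₂; swap)
open import Data.Sum.Base as Sum using (_⊎_; inj₁; inj₂)
open import Data.Vec.Base using (tabulate)
open import Data.Vec.Properties using (lookup∘tabulate; []=⇒lookup; lookup⇒[]=)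
open import Function.Base using (_∘_)
open import Function.Bundles
  using (_↔_; _⇔_; mk⇔; mk⤖; module Inverse; module Injection; module Equivalence)
open import Function.Construct.Composition using (_↔-∘_; _⇔-∘_)
open import Function.Construct.Identity using (↔-id)
open import Function.Construct.Symmetry using (↔-sym)
open import Function.Definitions using (Injective; Surjective)
open import Function.Properties.Bijection using (⤖⇒↔)
open import Function.Properties.Inverse using (↔⇒↣)
open import Level using (0ℓ)
open import Relation.Binary.Bundles using (Setoid; TotalOrder; TotalPreorder)
open import Relation.Binary.Consequences using (total∧dec⇒dec)
open import Relation.Binary.Core using (Rel; _Preserves_⟶_)
open import Relation.Binary.Definitions
  using (Decidable; DecidableEquality; Maximum; Minimum; Transitive)
open import Relation.Binary.PropositionalEquality
  using (_≡_; _≗_; refl; sym; trans; cong; cong₂; subst; subst₂; isEquivalence)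
open import Relation.Binary.PropositionalEquality.Algebra using (isMagma)
open import Relation.Binary.Structures using (IsPartialOrder; IsTotalOrder)
open import Relation.Nullary.Decidable
  using (does; yes; no; ¬?; _→-dec_; via-injection; dec-true)
open import Relation.Nullary.Negation using (¬_; contradiction)
open import Relation.Unary using (Pred) renaming (Decidable to Decidable₁)

open Equivalence using () renaming (to to ⇒; from to ⇐)

private
  variable
    m n : ℕ

-- Finite chains

-- If `y` were missed, punching it out of the codomain would inject `Fin (suc n)` into `Fin n`.
injective⇒surjective : {f : Fin n → Fin n} → Injective _≡_ _≡_ f → Surjective _≡_ _≡_ f
injective⇒surjective {n = suc n} {f} f-injective y with Fin.any? (λ x → f x Fin.≟ y)
... | yes (x , fx≡y) = x , λ { refl → fx≡y }
... | no  y∉f        = contradiction (Fin.injective⇒≤ g-injective) ℕ.1+n≰n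
  where
  y≢f : ∀ x → ¬ y ≡ f x
  y≢f x y≡fx = y∉f (x , sym y≡fx)

  g-injective : Injective _≡_ _≡_ (λ x → punchOut (y≢f x))
  g-injective {x} {x′} = f-injective ∘ Fin.punchOut-injective (y≢f x) (y≢f x′)

-- A pivot `y ≤ x` with `x ≤ f y` exists for every injection `f`, and monotonicity turns it into
-- `x ≤ f x`. A pivot of the inverse gives the other inequality. Isomorphisms between structures on
-- `Fin n` thereby become identities.
≤-automorphism-id : (i : Fin n ↔ Fin n) → Inverse.to i Preserves _≤_ ⟶ _≤_ →
                    ∀ x → Inverse.to i x ≡ x
≤-automorphism-id i mono x = Fin.≤-antisym fx≤x x≤fx
  where
  open Inverse i

  x≤fx : x ≤ to x
  x≤fx with y , y≤x , x≤fy ← Fin.injective⇒existsPivot (Injection.injective (↔⇒↣ i)) x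
    = Fin.≤-trans x≤fy (mono y≤x)

  fx≤x : to x ≤ x
  fx≤x with y , y≤x , x≤gy ← Fin.injective⇒existsPivot (Injection.injective (↔⇒↣ (↔-sym i))) x
    = Fin.≤-trans (subst (to x ≤_) (strictlyInverseˡ y) (mono x≤gy)) y≤x

module _ {A : Set} {_≼_ : Rel A 0ℓ} (isTotalOrder : IsTotalOrder _≡_ _≼_)
         (size : Fin n ↔ A) where

  private
    module ≼ = IsTotalOrder isTotalOrder
    open Inverse size

    _≟_ : DecidableEquality A
    _≟_ = via-injection (↔⇒↣ (↔-sym size)) Fin._≟_

    _≼?_ : Decidable _≼_
    _≼?_ = total∧dec⇒dec ≼.reflexive ≼.antisym ≼.total _≟_

    below : A → Subset n
    below x = tabulate (λ i → does (¬? (x ≼? to i)))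

    ∈-below⁺ : ∀ {x i} → ¬ (x ≼ to i) → i ∈ below x
    ∈-below⁺ {x} {i} x⋠i = lookup⇒[]= i (below x)
      (trans (lookup∘tabulate _ i) (dec-true (¬? (x ≼? to i)) x⋠i))

    ∈-below⁻ : ∀ {x i} → i ∈ below x → ¬ (x ≼ to i)
    ∈-below⁻ {x} {i} i∈ with x ≼? to i | trans (sym (lookup∘tabulate _ i)) ([]=⇒lookup i∈)
    ... | no x⋠i | _ = x⋠i

    from∉below : ∀ x → ¬ (from x ∈ below x)
    from∉below x x∈ = ∈-below⁻ x∈ (≼.reflexive (sym (strictlyInverseˡ x)))

    ∣below∣<n : ∀ x → ∣ below x ∣ ℕ.< n
    ∣below∣<n x = subst (∣ below x ∣ ℕ.<_) (∣⊤∣≡n n)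
      (p⊂q⇒∣p∣<∣q∣ ((λ _ → ∈⊤) , from x , ∈⊤ , from∉below x))

    -- The number of elements strictly below `x`, which is less than `n` because `x` is not below
    -- itself.
    rank : A → Fin n
    rank x = fromℕ< (∣below∣<n x)

    below-mono : ∀ {x y} → x ≼ y → ∣ below x ∣ ℕ.≤ ∣ below y ∣
    below-mono x≼y = p⊆q⇒∣p∣≤∣q∣
      (λ i∈ → ∈-below⁺ (λ y≼i → ∈-below⁻ i∈ (≼.trans x≼y y≼i)))

    below-cancel : ∀ {x y} → ∣ below x ∣ ℕ.≤ ∣ below y ∣ → x ≼ y
    below-cancel {x} {y} x≤y with x ≼? y | ≼.total x y
    ... | yes x≼y | _        = x≼y
    ... | no  _   | inj₁ x≼y = x≼y
    ... | no  x⋠y | inj₂ y≼x = contradiction x≤y (ℕ.<⇒≱ (p⊂q⇒∣p∣<∣q∣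
      ( (λ i∈ → ∈-below⁺ (λ x≼i → ∈-below⁻ i∈ (≼.trans y≼x x≼i)))
      , from y
      , ∈-below⁺ (x⋠y ∘ subst (x ≼_) (strictlyInverseˡ y))
      , from∉below y)))

    rank-⇔ : ∀ x y → x ≼ y ⇔ rank x ≤ rank y
    rank-⇔ x y = mk⇔
      (subst₂ ℕ._≤_ (sym (Fin.toℕ-fromℕ< _)) (sym (Fin.toℕ-fromℕ< _)) ∘ below-mono)
      (below-cancel ∘ subst₂ ℕ._≤_ (Fin.toℕ-fromℕ< (∣below∣<n x)) (Fin.toℕ-fromℕ< (∣below∣<n y)))

    rank-injective : Injective _≡_ _≡_ rank
    rank-injective {x} {y} eq = ≼.antisym
      (⇐ (rank-⇔ x y) (Fin.≤-reflexive eq)) (⇐ (rank-⇔ y x) (Fin.≤-reflexive (sym eq)))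

    rank∘size-injective : Injective _≡_ _≡_ (rank ∘ to)
    rank∘size-injective = Injection.injective (↔⇒↣ size) ∘ rank-injective

    rank∘size : Fin n ↔ Fin n
    rank∘size = ⤖⇒↔ (mk⤖ (rank∘size-injective , injective⇒surjective rank∘size-injective))

  abstract
    enumerate : ∃ λ (i : Fin n ↔ A) →
                ∀ (x y : Fin n) → x ≤ y ⇔ (Inverse.to i x ≼ Inverse.to i y)
    enumerate = size ↔-∘ ↔-sym rank∘size , λ x y → mk⇔
      (⇐ (rank-⇔ _ _) ∘ subst₂ _≤_ (sym (rank-at x)) (sym (rank-at y)))
      (subst₂ _≤_ (rank-at x) (rank-at y) ∘ ⇒ (rank-⇔ _ _))
      where
      rank-at : ∀ x → rank (to (Inverse.from rank∘size x)) ≡ x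
      rank-at = Inverse.strictlyInverseˡ rank∘size

-- Induction on `m`: if `Q` fails at 1, downward closure leaves only zero; otherwise the shifted
-- predicate satisfies the same hypotheses.
greatest : {Q : Pred (Fin (suc m)) 0ℓ} → Decidable₁ Q →
           (∀ (x y : Fin (suc m)) → x ≤ y → Q y → Q x) → Q zero →
           ∃ λ (t : Fin (suc m)) → ∀ x → x ≤ t ⇔ Q x
greatest {m = zero}  Q? down Q₀ = zero , λ { zero → mk⇔ (λ _ → Q₀) (λ _ → z≤n) }
greatest {m = suc m} Q? down Q₀ with Q? 1F
... | no ¬Q₁ = zero , λ
  { zero    → mk⇔ (λ _ → Q₀) (λ _ → z≤n)
  ; (suc x) → mk⇔ (λ ()) (λ Qx → contradiction (down 1F (suc x) (s≤s z≤n) Qx) ¬Q₁)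
  }
... | yes Q₁
  with t , t-max ← greatest (Q? ∘ suc) (λ x y → down (suc x) (suc y) ∘ s≤s) Q₁ = suc t , λ
  { zero    → mk⇔ (λ _ → Q₀) (λ _ → z≤n)
  ; (suc x) → mk⇔ (λ { (s≤s x≤t) → ⇒ (t-max x) x≤t }) (s≤s ∘ ⇐ (t-max x))
  }

-- Total preorders on a chain extending its order

indicator : {Q : Pred (Fin m) 0ℓ} → Decidable₁ Q → Fin m → Fin 2
indicator Q? k with Q? k
... | yes _ = 1F
... | no  _ = 0F

indicator≡1⇔ : {Q : Pred (Fin m) 0ℓ} (Q? : Decidable₁ Q) → ∀ k → indicator Q? k ≡ 1F ⇔ Q k
indicator≡1⇔ Q? k with Q? k
... | yes Qk = mk⇔ (λ _ → Qk) (λ _ → refl)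
... | no ¬Qk = mk⇔ (λ ()) (λ Qk → contradiction Qk ¬Qk)

≡1-extensional : {i j : Fin 2} → (i ≡ 1F → j ≡ 1F) → (j ≡ 1F → i ≡ 1F) → i ≡ j
≡1-extensional {0F} {0F} _ _ = refl
≡1-extensional {0F} {1F} _ h with () ← h refl
≡1-extensional {1F}      h _ = sym (h refl)

-- A code of s is described by a predicate instead of being given as a function,
-- because without extensionality s has many codes, equal only pointwise.
hasCardinality-2^ : ∀ {a ℓ} (S : Setoid a ℓ) → let open Setoid S in
  (f : (Fin m → Fin 2) → Carrier) →
  (∀ {b c} → f b ≈ f c → ∀ k → b k ≡ 1F → c k ≡ 1F) →
  (∀ s → ∃ λ (Q : Pred (Fin m) 0ℓ) → Decidable₁ Q × (∀ b → (∀ k → b k ≡ 1F ⇔ Q k) → f b ≈ s)) →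
  HasCardinality S (2 ^ m)
hasCardinality-2^ {m} S f f-reflects f-covers = record
  { to        = f ∘ finToFun
  ; cong      = λ { refl → S.refl }
  ; bijective = injective , surjective
  }
  where
  module S = Setoid S

  injective : Injective _≡_ S._≈_ (f ∘ finToFun)
  injective {x} {y} eq = trans (sym (Fin.funToFin-finToFin {m} x))
    (trans (funToFin-cong codes≗) (Fin.funToFin-finToFin {m} y))
    where
    codes≗ : finToFun x ≗ finToFun y
    codes≗ k = ≡1-extensional (f-reflects eq k) (f-reflects (S.sym eq) k)

    funToFin-cong : ∀ {m} {b c : Fin m → Fin 2} → b ≗ c → funToFin b ≡ funToFin c
    funToFin-cong {zero}  b≗c = refl
    funToFin-cong {suc m} b≗c = cong₂ combine (b≗c zero) (funToFin-cong (b≗c ∘ suc))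

  surjective : Surjective _≡_ S._≈_ (f ∘ finToFun)
  surjective s with Q , Q? , f≈s ← f-covers s = funToFin (indicator Q?) , λ
    { refl → f≈s _ (λ k → subst (λ i → i ≡ 1F ⇔ Q k)
        (sym (Fin.finToFun-funToFin (indicator Q?) k)) (indicator≡1⇔ Q? k)) }

-- Bit k of the code tells whether k and its successor k + 1 are linked, i.e.
-- whether they are equivalent in the preorder.
Linked : (Fin m → Fin 2) → Rel (Fin (suc m)) 0ℓ
Linked b x y = ∀ k → y ≤ k → k < x → b k ≡ 1F

linked? : (b : Fin m → Fin 2) → Decidable (Linked b)
linked? b x y = Fin.all? (λ k → (y Fin.≤? k) →-dec ((k Fin.<? x) →-dec (b k Fin.≟ 1F)))

≤⇒linked : (b : Fin m → Fin 2) → ∀ {x y} → x ≤ y → Linked b x y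
≤⇒linked b x≤y k y≤k k<x = contradiction (ℕ.≤-trans x≤y y≤k) (ℕ.<⇒≱ k<x)

-- Every `k` from `z` up to `x` lies either between `y` and `x` or between `z` and `y`.
linked-trans : (b : Fin m → Fin 2) → Transitive (Linked b)
linked-trans b {j = y} xy yz k z≤k k<x with y Fin.≤? k
... | yes y≤k = xy k y≤k k<x
... | no  y≰k = yz k z≤k (ℕ.≰⇒> y≰k)

-- The only index between the two neighbours is `k`, so the relation gives back each bit.
linked-suc : (b : Fin m → Fin 2) → ∀ k → b k ≡ 1F ⇔ Linked b (suc k) (inject₁ k)
linked-suc b k = mk⇔
  (λ bk l k≤l l≤k → subst (λ i → b i ≡ 1F)
    (Fin.≤-antisym (subst (ℕ._≤ toℕ l) (Fin.toℕ-inject₁ k) k≤l) (ℕ.s≤s⁻¹ l≤k)) bk)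
  (λ p → p k (ℕ.≤-reflexive (Fin.toℕ-inject₁ k)) ℕ.≤-refl)

-- A transitive relation containing the order is determined by its values on neighbours: a linked
-- pair is joined by descending one step at a time.
linked-⇔ : {_∼_ : Rel (Fin (suc m)) 0ℓ} → (∀ {x y} → x ≤ y → x ∼ y) → Transitive _∼_ →
           {b : Fin m → Fin 2} → (∀ k → b k ≡ 1F ⇔ (suc k ∼ inject₁ k)) →
           ∀ x y → Linked b x y ⇔ (x ∼ y)
linked-⇔ {_∼_ = _∼_} ≤⇒∼ ∼-trans {b} b-code x y = mk⇔
  (<-weakInduction (λ x → Linked b x y → x ∼ y) (λ _ → ≤⇒∼ z≤n) step x)
  -- For `y ≤ k < x` the chain `k + 1 ≤ x ∼ y ≤ k` relates the neighbours at `k`.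
  (λ x∼y k y≤k k<x → ⇐ (b-code k) (∼-trans (≤⇒∼ k<x) (∼-trans x∼y
    (≤⇒∼ (subst (toℕ y ℕ.≤_) (sym (Fin.toℕ-inject₁ k)) y≤k)))))
  where
  step : ∀ k → (Linked b (inject₁ k) y → inject₁ k ∼ y) → Linked b (suc k) y → suc k ∼ y
  step k rec linked with suc k Fin.≤? y
  ... | yes k<y = ≤⇒∼ k<y
  ... | no  k≮y = ∼-trans (⇒ (b-code k) (linked k (ℕ.s≤s⁻¹ (ℕ.≰⇒> k≮y)) ℕ.≤-refl))
    (rec (λ l y≤l l<k → linked l y≤l
      (ℕ.<-trans (subst (toℕ l ℕ.<_) (Fin.toℕ-inject₁ k) l<k) ℕ.≤-refl)))

-- Linearly ordered preorder forest `P`-frames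

frame : (Fin m → Fin 2) → PFrame
frame {m} b = record
  { Carrier        = Fin (suc m)
  ; _≤_            = _≤_
  ; _P_            = Linked b
  ; isPartialOrder = Fin.≤-isPartialOrder
  ; P-closed       = λ u≤x xPy y≤v →
      linked-trans b (≤⇒linked b u≤x) (linked-trans b xPy (≤⇒linked b y≤v))
  }

frame-isLinearForest : (b : Fin m → Fin 2) → IsLinearForest (suc m) (frame b)
frame-isLinearForest b = record
  { size             = ↔-id _
  ; P?               = linked? b
  ; isPreorderForest = record
    { P-refl  = ≤⇒linked b Fin.≤-refl
    ; P-trans = linked-trans b
    ; forest  = λ {_} {y} {z} _ _ → inj₂ (inj₂
        (Sum.map (≤⇒linked b) (≤⇒linked b) (Fin.≤-total y z)))
    }
  ; linearlyOrdered  = Fin.≤-total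
  }

frame-reflects-≅ : ∀ {b c : Fin m → Fin 2} → frame b ≅ᶠ frame c → ∀ k → b k ≡ 1F → c k ≡ 1F
frame-reflects-≅ {b = b} {c} φ k bk = ⇐ (linked-suc c k)
  (subst₂ (Linked c) (φ-id (suc k)) (φ-id (inject₁ k)) (⇒ (P-iso _ _) (⇒ (linked-suc b k) bk)))
  where
  open _≅ᶠ_ φ
  φ-id : ∀ x → to x ≡ x
  φ-id = ≤-automorphism-id iso (⇒ (≤-iso _ _))

-- With the carrier enumerated in increasing order, the bits of `P` are read off at neighbours.
-- Reflexivity and `P-closed` put the order inside `P`, so `linked-⇔` applies.
frame-covers : ((F , _) : ∃ (IsLinearForest (suc m))) →
  ∃ λ (Q : Pred (Fin m) 0ℓ) → Decidable₁ Q × (∀ b → (∀ k → b k ≡ 1F ⇔ Q k) → frame b ≅ᶠ F)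
frame-covers {m} (F , isLinearForest) =
  (λ k → σ (suc k) P σ (inject₁ k)) , (λ k → P? _ _) , λ b b-code → record
    { iso   = proj₁ sorted
    ; ≤-iso = proj₂ sorted
    ; P-iso = linked-⇔ (λ {x} {y} x≤y → P-closed ≤-refl P-refl (⇒ (proj₂ sorted x y) x≤y))
                       P-trans b-code
    }
  where
  open PFrame F renaming (_≤_ to _≼_)
  open IsLinearForest isLinearForest
  open IsPreorderForest isPreorderForest
  open IsPartialOrder isPartialOrder using () renaming (refl to ≤-refl)

  sorted : ∃ λ (i : Fin (suc m) ↔ Carrier) → ∀ x y → x ≤ y ⇔ (Inverse.to i x ≼ Inverse.to i y)
  sorted = enumerate (record { isPartialOrder = isPartialOrder ; total = linearlyOrdered }) size

  σ : Fin (suc m) → Carrier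
  σ = Inverse.to (proj₁ sorted)

linearForests-cardinality : ∀ m → HasCardinality (LinearForests (suc m)) (2 ^ m)
linearForests-cardinality m = hasCardinality-2^ (LinearForests (suc m))
  (λ b → frame b , frame-isLinearForest b) frame-reflects-≅ frame-covers

-- Semirings on chains

module _ {a ℓ₁ ℓ₂} {O : TotalPreorder a ℓ₁ ℓ₂}
         (minOp : MinOperator O) (maxOp : MaxOperator O) where

  open TotalPreorder O using () renaming (_≲_ to _≼_; total to ≼-total; trans to ≼-trans)
  open MinMaxOp minOp maxOp
  open MinOperator minOp using (_⊓_)
  open MaxOperator maxOp using (_⊔_)

  ≼-⊔⁻ : ∀ {z} x y → z ≼ x ⊔ y → z ≼ x ⊎ z ≼ y
  ≼-⊔⁻ x y z≼ with ≼-total x y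
  ... | inj₁ x≼y = inj₂ (≼-trans z≼ (⊔-lub x≼y (TotalPreorder.refl O)))
  ... | inj₂ y≼x = inj₁ (≼-trans z≼ (⊔-lub (TotalPreorder.refl O) y≼x))

  -- This describes a unary-determined product by the elements below it, which reduces semiring laws
  -- to propositional reasoning.
  ≼-⊓⊔⊓ : ∀ {z} w x y v → z ≼ (w ⊓ x) ⊔ (y ⊓ v) ⇔ (z ≼ w × z ≼ x ⊎ z ≼ y × z ≼ v)
  ≼-⊓⊔⊓ w x y v = mk⇔
    (Sum.map (λ z≼ → x≤y⊓z⇒x≤y w x z≼ , x≤y⊓z⇒x≤z w x z≼)
             (λ z≼ → x≤y⊓z⇒x≤y y v z≼ , x≤y⊓z⇒x≤z y v z≼) ∘ ≼-⊔⁻ _ _)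
    Sum.[ (λ (z≼w , z≼x) → x≤y⇒x≤y⊔z (y ⊓ v) (⊓-glb z≼w z≼x))
        , (λ (z≼y , z≼v) → x≤y⇒x≤z⊔y (w ⊓ x) (⊓-glb z≼y z≼v)) ]′

-- The semiring of a closure operator on a chain

module ClosureSemiring
  {A : Set} {R : Rel A 0ℓ} (isTotalOrder : IsTotalOrder _≡_ R)
  (⊥ ⊤ : A) (⊥-min : Minimum R ⊥) (⊤-max : Maximum R ⊤)
  (f : A → A) (f-mono : f Preserves R ⟶ R)
  (f-infl : ∀ x → R x (f x)) (f-idem : ∀ x → R (f (f x)) (f x)) (f-⊥ : R (f ⊥) ⊥) where

  infix 4 _≼_
  _≼_ : Rel A 0ℓ
  _≼_ = R

  private
    module ≼ = IsTotalOrder isTotalOrder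

    O : TotalOrder 0ℓ 0ℓ 0ℓ
    O = record { isTotalOrder = isTotalOrder }

  module Min = NaturalMin O
  module Max = NaturalMax O
  open Min using (_⊓_)
  open Max using (_⊔_)

  infixl 7 _·_
  _·_ : Op₂ A
  x · y = (f x ⊓ y) ⊔ (x ⊓ f y)

  ≼-· : ∀ {z} x y → z ≼ x · y ⇔ (z ≼ f x × z ≼ y ⊎ z ≼ x × z ≼ f y)
  ≼-· x y = ≼-⊓⊔⊓ Min.minOperator Max.maxOperator (f x) y x (f y)

  private
    extensional : ∀ {x y} → (∀ {z} → z ≼ x → z ≼ y) → (∀ {z} → z ≼ y → z ≼ x) → x ≡ y
    extensional x⊆y y⊆x = ≼.antisym (x⊆y ≼.refl) (y⊆x ≼.refl)

    ·-comm-≼ : ∀ x y {z} → z ≼ x · y → z ≼ y · x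
    ·-comm-≼ x y = ⇐ (≼-· y x) ∘ Sum.map swap swap ∘ Sum.swap ∘ ⇒ (≼-· x y)

    ·-comm : Commutative _≡_ _·_
    ·-comm x y = extensional (·-comm-≼ x y) (·-comm-≼ y x)

    ·-idem : Idempotent _≡_ _·_
    ·-idem x = extensional (Sum.[ proj₂ , proj₁ ]′ ∘ ⇒ (≼-· x x))
      (λ z≼x → ⇐ (≼-· x x) (inj₂ (z≼x , ≼.trans z≼x (f-infl x))))

    -- f turns products into meets, hence z ≼ (x · y) · w expands to a condition
    -- symmetric in x, y and w.
    f-· : ∀ {z} x y → z ≼ f (x · y) ⇔ (z ≼ f x × z ≼ f y)
    f-· {z} x y = mk⇔
      (λ z≼ → ≼.trans z≼ (≼.trans (f-mono (·≼f x y)) (f-idem x))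
            , ≼.trans z≼ (≼.trans (f-mono (≼.trans (·-comm-≼ x y ≼.refl) (·≼f y x))) (f-idem y)))
      bound
      where
      ·≼f : ∀ x y → x · y ≼ f x
      ·≼f x y = Sum.[ proj₁ , (λ (z≼x , _) → ≼.trans z≼x (f-infl x)) ]′ (⇒ (≼-· x y) ≼.refl)

      bound : z ≼ f x × z ≼ f y → z ≼ f (x · y)
      -- If `x ≼ y` then `x ≼ f y`, so `x ≼ x · y` and `f x ≼ f (x · y)`; the other case is
      -- symmetric.
      bound (z≼fx , z≼fy) with ≼.total x y
      ... | inj₁ x≼y = ≼.trans z≼fx (f-mono (⇐ (≼-· x y) (inj₂ (≼.refl , ≼.trans x≼y (f-infl y)))))
      ... | inj₂ y≼x = ≼.trans z≼fy (f-mono (⇐ (≼-· x y) (inj₁ (≼.trans y≼x (f-infl x) , ≼.refl))))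

    ·-assoc-≼ : ∀ x y w {z} → z ≼ (x · y) · w → z ≼ x · (y · w)
    ·-assoc-≼ x y w z≼ with ⇒ (≼-· (x · y) w) z≼
    ... | inj₁ (z≼fxy , z≼w) with z≼fx , z≼fy ← ⇒ (f-· x y) z≼fxy =
      ⇐ (≼-· x (y · w)) (inj₁ (z≼fx , ⇐ (≼-· y w) (inj₁ (z≼fy , z≼w))))
    ... | inj₂ (z≼xy , z≼fw) with ⇒ (≼-· x y) z≼xy
    ...   | inj₁ (z≼fx , z≼y) =
      ⇐ (≼-· x (y · w)) (inj₁ (z≼fx , ⇐ (≼-· y w) (inj₂ (z≼y , z≼fw))))
    ...   | inj₂ (z≼x , z≼fy) =
      ⇐ (≼-· x (y · w)) (inj₂ (z≼x , ⇐ (f-· y w) (z≼fy , z≼fw)))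

    ·-assoc : Associative _≡_ _·_
    ·-assoc x y w = ≼.antisym (·-assoc-≼ x y w ≼.refl)
      -- The reverse inequality is the same one for `w`, `y`, `x`, rewritten by commutativity.
      (subst₂ _≼_ (trans (·-comm (w · y) x) (cong (x ·_) (·-comm w y)))
                  (trans (·-comm w (y · x)) (cong (_· w) (·-comm y x)))
        (·-assoc-≼ w y x ≼.refl))

    ·-monoʳ : ∀ x → (x ·_) Preserves _≼_ ⟶ _≼_
    ·-monoʳ x {y} {w} y≼w = ⇐ (≼-· x w)
      (Sum.map (λ (p , q) → p , ≼.trans q y≼w) (λ (p , q) → p , ≼.trans q (f-mono y≼w))
        (⇒ (≼-· x y) ≼.refl))

    -- On a chain every monotone map preserves binary joins.
    ·-distribˡ-⊔ : _DistributesOverˡ_ _≡_ _·_ _⊔_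
    ·-distribˡ-⊔ x = Max.mono-≤-distrib-⊔ (cong (x ·_)) (·-monoʳ x)

  semiring : Semiring
  semiring = record
    { Carrier                  = A
    ; _∨_                      = _⊔_
    ; _·_                      = _·_
    ; ∨-isCommutativeSemigroup = Max.⊔-isCommutativeSemigroup
    ; ·-isSemigroup            = record
      { isMagma = isMagma _·_
      ; assoc   = ·-assoc
      }
    ; distrib                  = ·-distribˡ-⊔
      , comm∧distrˡ⇒distrʳ {_∙_ = _·_} {_◦_ = _⊔_} ·-comm ·-distribˡ-⊔
    }

  open Semiring semiring using () renaming (_≤_ to _≤∨_)

  ≼⇔≤ : ∀ x y → x ≼ y ⇔ (x ≤∨ y)
  ≼⇔≤ x y = mk⇔ Max.x≤y⇒x⊔y≈y Max.x⊔y≈y⇒x≤y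

  linear : Linear semiring
  linear = record
    { isPartialOrder = record
      { isPreorder = record
        { isEquivalence = isEquivalence
        ; reflexive     = λ { refl → Max.⊔-idem _ }
        ; trans         = λ x≤y y≤z → ⇒ (≼⇔≤ _ _) (≼.trans (⇐ (≼⇔≤ _ _) x≤y) (⇐ (≼⇔≤ _ _) y≤z))
        }
      ; antisym = λ x≤y y≤x → ≼.antisym (⇐ (≼⇔≤ _ _) x≤y) (⇐ (≼⇔≤ _ _) y≤x)
      }
    ; total = λ x y → Sum.map (⇒ (≼⇔≤ x y)) (⇒ (≼⇔≤ y x)) (≼.total x y)
    }

  ·-⊤ : ∀ x → x · ⊤ ≡ f x
  ·-⊤ x = extensional
    (Sum.[ proj₁ , (λ (z≼x , _) → ≼.trans z≼x (f-infl x)) ]′ ∘ ⇒ (≼-· x ⊤))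
    (λ z≼fx → ⇐ (≼-· x ⊤) (inj₁ (z≼fx , ⊤-max _)))

  unaryDetermined : UnaryDetermined semiring linear
  unaryDetermined = ⊤ , (λ x → ⇒ (≼⇔≤ x ⊤) (⊤-max x)) , λ x y → sym (cong₂ _⊔_
    (trans (∧≡⊓ (x · ⊤) y) (cong (_⊓ y) (·-⊤ x)))
    (trans (∧≡⊓ x (⊤ · y)) (cong (x ⊓_) (trans (·-comm ⊤ y) (·-⊤ y)))))
    where
    ≤∨-totalOrder : TotalOrder 0ℓ 0ℓ 0ℓ
    ≤∨-totalOrder = record { isTotalOrder = linear }

    open NaturalMin ≤∨-totalOrder using (x≤y⇒x⊓y≈x; x≤y⇒y⊓x≈x) renaming (_⊓_ to _∧_)

    -- The meet in `UnaryDetermined` is computed from the order defined by joins; it is the original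
    -- minimum because the two orders agree.
    ∧≡⊓ : ∀ x y → x ∧ y ≡ x ⊓ y
    ∧≡⊓ x y = Sum.[
        (λ x≼y → trans (x≤y⇒x⊓y≈x (⇒ (≼⇔≤ x y) x≼y)) (sym (Min.x≤y⇒x⊓y≈x x≼y)))
      , (λ y≼x → trans (x≤y⇒y⊓x≈x (⇒ (≼⇔≤ y x) y≼x)) (sym (Min.x≤y⇒y⊓x≈x y≼x)))
      ]′ (≼.total x y)

  isUnaryDeterminedChain : Fin n ↔ A → IsUnaryDeterminedChain n semiring
  isUnaryDeterminedChain size = record
    { size             = size
    ; hasZero          = ⊥ , (λ x → ⇒ (≼⇔≤ ⊥ x) (⊥-min x))
                           , ⊥-zeroˡ , λ x → trans (·-comm x ⊥) (⊥-zeroˡ x)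
    ; commutative      = ·-comm
    ; doublyIdempotent = Max.⊔-idem , ·-idem
    ; linear           = linear
    ; unaryDetermined  = unaryDetermined
    }
    where
    ⊥-zeroˡ : ∀ x → ⊥ · x ≡ ⊥
    ⊥-zeroˡ x = ≼.antisym
      (Sum.[ (λ (z≼f⊥ , _) → ≼.trans z≼f⊥ f-⊥) , proj₁ ]′ (⇒ (≼-· ⊥ x) ≼.refl)) (⊥-min _)

-- The element zero of the chain is ⊥ and has no bit; bit k of the code links
-- suc k to suc (suc k).
module _ (b : Fin m → Fin 2) where

  private
    closure₊ : ∀ y → ∃ λ (t : Fin (suc m)) → ∀ x → x ≤ t ⇔ Linked b x y
    closure₊ y = greatest (λ x → linked? b x y)
      (λ x x′ x≤x′ → linked-trans b (≤⇒linked b x≤x′)) (≤⇒linked b z≤n)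

  closure : Fin (2 ℕ.+ m) → Fin (2 ℕ.+ m)
  closure zero    = zero
  closure (suc y) = suc (proj₁ (closure₊ y))

  ≤-closure : ∀ x y → suc x ≤ closure (suc y) ⇔ Linked b x y
  ≤-closure x y = mk⇔
    (λ { (s≤s x≤) → ⇒ (proj₂ (closure₊ y) x) x≤ })
    (s≤s ∘ ⇐ (proj₂ (closure₊ y) x))

  private
    closure-inflationary : ∀ x → x ≤ closure x
    closure-inflationary zero    = z≤n
    closure-inflationary (suc x) = ⇐ (≤-closure x x) (≤⇒linked b Fin.≤-refl)

    -- Together with inflationarity this yields both monotonicity and idempotence.
    closure-least : ∀ x y → x ≤ closure y → closure x ≤ closure y
    closure-least zero    y       _  = z≤n
    closure-least (suc x) (suc y) x≤ = ⇐ (≤-closure _ y)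
      (linked-trans b (⇒ (proj₂ (closure₊ x) _) Fin.≤-refl) (⇒ (≤-closure x y) x≤))

    closure-mono : closure Preserves _≤_ ⟶ _≤_
    closure-mono {x} {y} x≤y = closure-least x y (Fin.≤-trans x≤y (closure-inflationary y))

  open ClosureSemiring Fin.≤-isTotalOrder zero (fromℕ (suc m)) (λ _ → z≤n) Fin.≤fromℕ
    closure closure-mono closure-inflationary (λ x → closure-least (closure x) x Fin.≤-refl) z≤n
    public
    using (_·_; ≼-·; ≼⇔≤; ·-⊤; module Max)
    renaming (semiring to chain; isUnaryDeterminedChain to chain-isUnaryDeterminedChain)

-- An isomorphism preserves joins, hence the order, so it is the identity and the two products
-- coincide.
chain-reflects-· : ∀ {b c : Fin m → Fin 2} → chain b ≅ˢ chain c → ∀ x y → _·_ b x y ≡ _·_ c x y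
chain-reflects-· {b = b} {c} φ x y = trans (sym (φ-id _))
  (trans (·-homo x y) (cong₂ (_·_ c) (φ-id x) (φ-id y)))
  where
  open _≅ˢ_ φ
  φ-id : ∀ x → to x ≡ x
  φ-id = ≤-automorphism-id iso (λ {x} {y} x≤y → ⇐ (≼⇔≤ c (to x) (to y))
    (trans (sym (∨-homo x y)) (cong to (⇒ (≼⇔≤ b x y) x≤y))))

-- Equal products have equal closures, by `·-⊤`, and the closure of an element shows whether its
-- successor is linked to it.
chain-reflects-≅ : ∀ {b c : Fin m → Fin 2} → chain b ≅ˢ chain c → ∀ k → b k ≡ 1F → c k ≡ 1F
chain-reflects-≅ {b = b} {c} φ k bk = ⇐ (linked-suc c k) (⇒ (≤-closure c (suc k) (inject₁ k))
  (subst (suc (suc k) ≤_) (closure≗ (suc (inject₁ k)))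
    (⇐ (≤-closure b (suc k) (inject₁ k)) (⇒ (linked-suc b k) bk))))
  where
  closure≗ : closure b ≗ closure c
  closure≗ x = trans (sym (·-⊤ b x)) (trans (chain-reflects-· {b = b} {c} φ x _) (·-⊤ c x))

-- Every unary-determined chain comes from a code

module UnaryDeterminedChain {S : Semiring}
  (isChain : IsUnaryDeterminedChain (2 ℕ.+ m) S) where

  open Semiring S renaming (_≤_ to _≼_; _·_ to _∙_)
  open IsUnaryDeterminedChain isChain
  module ≼ = IsTotalOrder linear

  O : TotalOrder 0ℓ 0ℓ 0ℓ
  O = record { isTotalOrder = linear }

  private
    sorted : ∃ λ (i : Fin (2 ℕ.+ m) ↔ Carrier) →
               ∀ (x y : Fin (2 ℕ.+ m)) → x ≤ y ⇔ (Inverse.to i x ≼ Inverse.to i y)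
    sorted = enumerate linear size

  enumeration : Fin (2 ℕ.+ m) ↔ Carrier
  enumeration = proj₁ sorted

  open Inverse enumeration using ()
    renaming (to to σ; from to σ⁻¹; strictlyInverseˡ to σ-σ⁻¹) public

  σ-⇔ : ∀ x y → x ≤ y ⇔ (σ x ≼ σ y)
  σ-⇔ = proj₂ sorted

  ⊤ : Carrier
  ⊤ = proj₁ unaryDetermined

  ⊤-max : ∀ x → x ≼ ⊤
  ⊤-max = proj₁ (proj₂ unaryDetermined)

  ∙-monoˡ : ∀ {x y} z → x ≼ y → x ∙ z ≼ y ∙ z
  ∙-monoˡ z x≼y = trans (sym (proj₂ distrib z _ _)) (cong (_∙ z) x≼y)

  ∙-monoʳ : ∀ {x y} z → x ≼ y → z ∙ x ≼ z ∙ y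
  ∙-monoʳ z x≼y = trans (sym (proj₁ distrib z _ _)) (cong (z ∙_) x≼y)

  ≼-∙⊤ : ∀ x → x ≼ x ∙ ⊤
  ≼-∙⊤ x = subst (_≼ x ∙ ⊤) (proj₂ doublyIdempotent x) (∙-monoʳ x (⊤-max x))

  -- Multiplying by `⊤` twice is multiplying once, by associativity and idempotence.
  ∙⊤-least : ∀ {x y} → x ≼ y ∙ ⊤ → x ∙ ⊤ ≼ y ∙ ⊤
  ∙⊤-least {x} {y} x≼y⊤ = subst (x ∙ ⊤ ≼_)
    (trans (IsSemigroup.assoc ·-isSemigroup y ⊤ ⊤) (cong (y ∙_) (proj₂ doublyIdempotent ⊤)))
    (∙-monoˡ ⊤ x≼y⊤)

  ≼-∙ : ∀ {z} x y → z ≼ x ∙ y ⇔ (z ≼ x ∙ ⊤ × z ≼ y ⊎ z ≼ x × z ≼ y ∙ ⊤)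
  ≼-∙ {z} x y = subst₂ (λ u v → z ≼ u ⇔ (z ≼ x ∙ ⊤ × z ≼ y ⊎ z ≼ x × z ≼ v))
    (sym (proj₂ (proj₂ unaryDetermined) x y)) (commutative ⊤ y)
    (≼-⊓⊔⊓ (NaturalMin.minOperator O) ∨-maxOperator (x ∙ ⊤) y x (⊤ ∙ y))
    where
    ∨-maxOperator : MaxOperator (TotalOrder.totalPreorder O)
    ∨-maxOperator = record
      { _⊔_       = _∨_
      ; x≤y⇒x⊔y≈y = λ x≼y → x≼y
      ; x≥y⇒x⊔y≈x = λ y≼x → trans (IsCommutativeSemigroup.comm ∨-isCommutativeSemigroup _ _) y≼x
      }

  σ0-min : ∀ x → σ zero ≼ x
  σ0-min x = subst (σ zero ≼_) (σ-σ⁻¹ x) (⇒ (σ-⇔ zero (σ⁻¹ x)) z≤n)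

  -- The annihilating minimum of `hasZero` is `σ zero`, since minima are unique.
  σ0-zeroˡ : ∀ x → σ zero ∙ x ≡ σ zero
  σ0-zeroˡ x with ⊥ , ⊥-min , ⊥-zeroˡ , _ ← hasZero =
    subst (λ y → y ∙ x ≡ y) (≼.antisym (⊥-min _) (σ0-min ⊥)) (⊥-zeroˡ x)

  LinkedAt : Pred (Fin m) 0ℓ
  LinkedAt k = σ (suc (suc k)) ≼ σ (suc (inject₁ k)) ∙ ⊤

  linkedAt? : Decidable₁ LinkedAt
  -- `≼` is an equation in `Carrier`, where equality is decidable through the bijection with `Fin`.
  linkedAt? k = via-injection (↔⇒↣ (↔-sym size)) Fin._≟_ _ _

  module _ (b : Fin m → Fin 2) (b-code : ∀ k → b k ≡ 1F ⇔ LinkedAt k) where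

    -- Away from the bottom, being below `σ y ∙ ⊤` is transitive and contains the order, so
    -- `linked-⇔` applies. The bottom is closed because it annihilates.
    σ-closure : ∀ x y → x ≤ closure b y ⇔ (σ x ≼ σ y ∙ ⊤)
    σ-closure zero    y       = mk⇔ (λ _ → σ0-min _) (λ _ → z≤n)
    σ-closure (suc x) zero    = mk⇔ (λ ())
      (λ x≼ → contradiction (⇐ (σ-⇔ (suc x) zero) (subst (σ (suc x) ≼_) (σ0-zeroˡ ⊤) x≼)) λ ())
    σ-closure (suc x) (suc y) =
      linked-⇔ {_∼_ = λ x y → σ (suc x) ≼ σ (suc y) ∙ ⊤}
        (λ {x} {y} x≤y → ≼.trans (⇒ (σ-⇔ (suc x) (suc y)) (s≤s x≤y)) (≼-∙⊤ _))
        (λ x∼y y∼z → ≼.trans x∼y (∙⊤-least y∼z)) b-code x y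
      ⇔-∘ ≤-closure b x y

    -- `≼-·` and `≼-∙` expand the two sides to conditions that `σ-⇔` and `σ-closure` match term by
    -- term.
    σ-· : ∀ x y z → z ≤ _·_ b x y ⇔ (σ z ≼ σ x ∙ σ y)
    σ-· x y z = mk⇔
      (λ z≤ → ⇐ (≼-∙ (σ x) (σ y)) (Sum.map
        (λ (p , q) → ⇒ (σ-closure z x) p , ⇒ (σ-⇔ z y) q)
        (λ (p , q) → ⇒ (σ-⇔ z x) p , ⇒ (σ-closure z y) q) (⇒ (≼-· b x y) z≤)))
      (λ z≼ → ⇐ (≼-· b x y) (Sum.map
        (λ (p , q) → ⇐ (σ-closure z x) p , ⇐ (σ-⇔ z y) q)
        (λ (p , q) → ⇐ (σ-⇔ z x) p , ⇐ (σ-closure z y) q) (⇒ (≼-∙ (σ x) (σ y)) z≼)))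

    chain-≅ : chain b ≅ˢ S
    chain-≅ = record
      { iso    = enumeration
      ; ∨-homo = λ x y → Sum.[
            (λ x≤y → trans (cong σ (⇒ (≼⇔≤ b x y) x≤y)) (sym (⇒ (σ-⇔ x y) x≤y)))
          , (λ y≤x → trans (cong σ (trans (Max.⊔-comm b x y) (⇒ (≼⇔≤ b y x) y≤x)))
              (trans (sym (⇒ (σ-⇔ y x) y≤x)) (∨-comm (σ y) (σ x))))
          ]′ (Fin.≤-total x y)
      ; ·-homo = λ x y → ≼.antisym (⇒ (σ-· x y _) Fin.≤-refl)
          (subst (_≼ σ (_·_ b x y)) (σ-σ⁻¹ _)
            (⇒ (σ-⇔ (σ⁻¹ (σ x ∙ σ y)) (_·_ b x y)) (⇐ (σ-· x y _) (≼.reflexive (σ-σ⁻¹ _)))))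
      }
      where open IsCommutativeSemigroup ∨-isCommutativeSemigroup using () renaming (comm to ∨-comm)

unaryDeterminedChains-cardinality :
  ∀ m → HasCardinality (UnaryDeterminedChains (2 ℕ.+ m)) (2 ^ m)
unaryDeterminedChains-cardinality m = hasCardinality-2^ (UnaryDeterminedChains (2 ℕ.+ m))
  (λ b → chain b , chain-isUnaryDeterminedChain b (↔-id _))
  (λ {b} {c} → chain-reflects-≅ {b = b} {c})
  λ (S , isChain) → let open UnaryDeterminedChain isChain in LinkedAt , linkedAt? , chain-≅

-- Identity elements

-- All bits from `e` on are set: `suc e` and everything above it form one class, and the nonzero
-- elements below `suc e` are singletons.
identityCode : Fin (suc m) → Fin m → Fin 2
identityCode e = indicator (λ k → e Fin.≤? k)

identityCode-≡1 : ∀ (e : Fin (suc m)) k → identityCode e k ≡ 1F ⇔ e ≤ k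
identityCode-≡1 e = indicator≡1⇔ (λ k → e Fin.≤? k)

chain-identity : (e : Fin (suc m)) → Identity _≡_ (suc e) (_·_ (identityCode e))
chain-identity e = (λ x → trans (comm (suc e) x) (identityʳ x)) , identityʳ
  where
  b = identityCode e
  open IsUnaryDeterminedChain (chain-isUnaryDeterminedChain b (↔-id _))
    using () renaming (commutative to comm)

  ≤-closure-e : ∀ x → x ≤ closure b (suc e)
  ≤-closure-e zero    = z≤n
  ≤-closure-e (suc x) = ⇐ (≤-closure b x e) (λ k e≤k _ → ⇐ (identityCode-≡1 e k) e≤k)

  -- Were `z` above `x`, the bit linking `z` to its predecessor would be set; but its index is less
  -- than `e`.
  closed-below : ∀ z x → z ≤ closure b x → z ≤ suc e → z ≤ x
  closed-below zero    x       _  _         = z≤n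
  closed-below (suc z) (suc x) z≤ (s≤s z≤e) with z Fin.≤? x
  ... | yes z≤x = s≤s z≤x
  closed-below (suc zero)    (suc x) z≤ _         | no z≰x = contradiction z≤n z≰x
  closed-below (suc (suc k)) (suc x) z≤ (s≤s k<e) | no z≰x = contradiction
    (⇒ (identityCode-≡1 e k) (⇒ (≤-closure b (suc k) x) z≤ k (ℕ.s≤s⁻¹ (ℕ.≰⇒> z≰x)) ℕ.≤-refl))
    (ℕ.<⇒≱ k<e)

  identityʳ : ∀ x → _·_ b x (suc e) ≡ x
  identityʳ x = Fin.≤-antisym
    (Sum.[ (λ (p , q) → closed-below _ x p q) , proj₁ ]′ (⇒ (≼-· b x (suc e)) Fin.≤-refl))
    (⇐ (≼-· b x (suc e)) (inj₂ (Fin.≤-refl , ≤-closure-e x)))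

module _ {S : Semiring} (isChain : IsUnaryDeterminedChain (2 ℕ.+ m) S) where

  open Semiring S using () renaming (_≤_ to _≼_; _·_ to _∙_)
  open UnaryDeterminedChain isChain

  -- An identity at the bottom would give `σ 1F ≡ σ zero ∙ σ 1F ≡ σ zero`.
  identity⇒≢σ0 : ∀ {ε} → Identity _≡_ ε _∙_ → ¬ (σ zero ≡ ε)
  identity⇒≢σ0 (identityˡ , _) refl = contradiction
    (⇐ (σ-⇔ 1F zero) (≼.reflexive (trans (sym (identityˡ (σ 1F))) (σ0-zeroˡ (σ 1F))))) λ ()

  -- If `e ≤ k`, the product with `⊤` of the lower neighbour at `k` is at least `σ (suc e) ∙ ⊤`,
  -- which is `⊤`. If `k < e` and the neighbours were linked, the upper one would lie below the
  -- product of the lower one with the identity, that is, below the lower one.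
  linkedAt-⇔ : ∀ e → Identity _≡_ (σ (suc e)) _∙_ → ∀ k → e ≤ k ⇔ LinkedAt k
  linkedAt-⇔ e (identityˡ , identityʳ) k = mk⇔
    (λ e≤k → ≼.trans (⊤-max _) (subst (_≼ σ (suc (inject₁ k)) ∙ ⊤) (identityˡ ⊤)
      (∙-monoˡ ⊤ (⇒ (σ-⇔ (suc e) (suc (inject₁ k)))
        (s≤s (subst (toℕ e ℕ.≤_) (sym (Fin.toℕ-inject₁ k)) e≤k))))))
    λ linked → ℕ.≮⇒≥ λ k<e → contradiction
      (⇐ (σ-⇔ (suc (suc k)) (suc (inject₁ k))) (subst (σ (suc (suc k)) ≼_) (identityʳ _)
        (⇐ (≼-∙ _ (σ (suc e))) (inj₁ (linked , ⇒ (σ-⇔ (suc (suc k)) (suc e)) (s≤s k<e))))))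
      (ℕ.<⇒≱ (s≤s (s≤s (ℕ.≤-reflexive (Fin.toℕ-inject₁ k)))))

unaryDeterminedChainsWithIdentity-cardinality :
  ∀ m → HasCardinality (UnaryDeterminedChainsWithIdentity (2 ℕ.+ m)) (suc m)
unaryDeterminedChainsWithIdentity-cardinality m = record
  { to        = chainWithIdentity
  ; cong      = λ { refl → ≅ˢ-refl }
  ; bijective = (λ {e} {e′} → injective e e′) , surjective
  }
  where
  module S = Setoid (UnaryDeterminedChainsWithIdentity (2 ℕ.+ m))

  chainWithIdentity : Fin (suc m) → S.Carrier
  chainWithIdentity e = chain (identityCode e)
    , chain-isUnaryDeterminedChain (identityCode e) (↔-id _) , suc e , chain-identity e

  injective : ∀ e e′ → chain (identityCode e) ≅ˢ chain (identityCode e′) → e ≡ e′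
  -- Both products agree, so this is uniqueness of the identity: `suc e · suc e′` equals each
  -- factor.
  injective e e′ φ = Fin.suc-injective (trans (sym (proj₂ (chain-identity e′) (suc e)))
    (trans (sym (chain-reflects-· {b = identityCode e} {identityCode e′} φ (suc e) (suc e′)))
           (proj₁ (chain-identity e) (suc e′))))

  surjective : Surjective _≡_ S._≈_ chainWithIdentity
  surjective (S , isChain , ε , ε-identity) = at (σ⁻¹ ε) (σ-σ⁻¹ ε)
    where
    open UnaryDeterminedChain isChain
    at : ∀ x → σ x ≡ ε → ∃ λ (e : Fin (suc m)) → ∀ {e′} → e′ ≡ e → chain (identityCode e′) ≅ˢ S
    at zero    σ0≡ε = contradiction σ0≡ε (identity⇒≢σ0 isChain ε-identity)
    at (suc e) refl = e , λ { refl → chain-≅ (identityCode e)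
      (λ k → linkedAt-⇔ isChain e ε-identity k ⇔-∘ identityCode-≡1 e k) }

theorem6p2 : (n : ℕ) →
    (n ≥ 1 → HasCardinality (LinearForests n) (2 ^ (n ∸ 1))) ×
    (n > 1 → HasCardinality (UnaryDeterminedChains n) (2 ^ (n ∸ 2)) ×
    HasCardinality (UnaryDeterminedChainsWithIdentity n) (n ∸ 1))
theorem6p2 zero          = (λ ()) , λ ()
theorem6p2 (suc zero)    = (λ _ → linearForests-cardinality 0) , λ { (s≤s ()) }
theorem6p2 (suc (suc m)) = (λ _ → linearForests-cardinality (suc m)) , λ _ →
  unaryDeterminedChains-cardinality m , unaryDeterminedChainsWithIdentity-cardinality m
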